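{- Let $c\ge1$ be an integer. Suppose that there are $2c$ targets in the graph and let $p_i=\frac{1}{2c}$ for every $i\in\{1,2,\ldots,2c\}$. Then any deterministic (possibly adaptive) algorithm requires in the worst case at least $\frac{n}{2}-c$ queries to locate at least one target, even when the graph is an unweighted cycle with $n$ vertices.
   Context: Graphs $G=(V,E)$, $|V|=n$, are connected, simple, undirected, with positive edge weights $w$ (unweighted: all weights $1$); $d$ is the shortest-path distance, and $N(v)$ is the set of neighbors of $v$. For $u\in N(v)$, $N(v,u)=\{x\in V: d(v,x)=w(vu)+d(u,x)\}$. The set of unknown (distinct) targets, placed by an adversary, is $T=\{t_1,\ldots,t_{2c}\}\subseteq V$. A direction query at $v$ independently directs with probability $p_i$ to $t_i$, in which case it returns a neighbor $u\in N(v)$ with $t_i\in N(v,u)$ (possibly chosen adversarially if there are several), without disclosing $i$; if $v=t_i$ this is revealed by the query with probability $p_i$. To locate a target means to determine with certainty some vertex that is a target. -}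

module Defs where

open import Data.Fin.Base using (Fin; toℕ; fromℕ<)
open import Data.Fin.Properties using (toℕ-fromℕ<; fromℕ<-toℕ; toℕ<n)
import Data.Fin.Properties as Fin
open import Data.Integer.Base using (+_)
open import Data.List.Base using (List; []; _∷_)
open import Data.Nat.Base as ℕ using (ℕ; zero; suc; NonZero; z≤n; s≤s)
import Data.Nat.Properties as ℕ
open import Data.Product.Base using (_×_; _,_; ∃-syntax; Σ-syntax)
open import Data.Rational.Base using (ℚ; 0ℚ; 1ℚ; _+_; _*_; _/_; _≤_; _<_)
open import Data.Rational.Properties using (+-0-commutativeMonoid; positive⁻¹)
open import Algebra.Properties.CommutativeMonoid.Sum +-0-commutativeMonoid using (sum)
open import Data.Sum.Base using (_⊎_; inj₁; inj₂; swap)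
open import Function.Bundles using (_↣_; Injection)
open import Relation.Binary.Construct.Closure.ReflexiveTransitive
  using (Star; ε; _◅_; _◅◅_; reverse)
open import Relation.Binary.PropositionalEquality
  using (_≡_; refl; sym; trans; cong; subst)
open import Relation.Nullary.Decidable.Core using (Dec; yes; no; map′; ⌊_⌋)
open import Relation.Nullary.Negation.Core using (¬_)
open import Data.Bool.Base using (if_then_else_)

-- The values  w u v  are meaningful for adjacent  u  and  v  only.
record Graph (n : ℕ) : Set₁ where
  field
    Adj         : Fin n → Fin n → Set
    Adj-sym     : ∀ {u v} → Adj u v → Adj v u
    Adj-irrefl  : ∀ {v} → ¬ Adj v v
    w           : Fin n → Fin n → ℚ
    w-sym       : ∀ {u v} → Adj u v → w u v ≡ w v u
    w-pos       : ∀ {u v} → Adj u v → 0ℚ < w u v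
    connected   : ∀ u v → Star Adj u v

  Walk : Fin n → Fin n → Set
  Walk = Star Adj

  weight : ∀ {u v} → Walk u v → ℚ
  weight ε = 0ℚ
  weight (_◅_ {u} {u′} _ ws) = w u u′ + weight ws

  -- As edge weights are positive, a lightest walk is a shortest path.
  IsDistance : Fin n → Fin n → ℚ → Set
  IsDistance u v δ =
    (Σ[ π ∈ Walk u v ] weight π ≡ δ) × (∀ (π : Walk u v) → δ ≤ weight π)

  -- x ∈N[ v , u ]  says that  u  is a neighbour of  v  and
  -- d(v,x) = w(vu) + d(u,x).
  _∈N[_,_] : Fin n → Fin n → Fin n → Set
  x ∈N[ v , u ] =
    Adj v u × (∃[ δ ] (IsDistance u x δ × IsDistance v x (w v u + δ)))

module _ {n : ℕ} where

  Succ : Fin n → Fin n → Set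
  Succ u v = (toℕ v ≡ suc (toℕ u)) ⊎ (suc (toℕ u) ≡ n × toℕ v ≡ 0)

  CycleAdj : Fin n → Fin n → Set
  CycleAdj u v = Succ u v ⊎ Succ v u

  cycle-irrefl : 3 ℕ.≤ n → {v : Fin n} → ¬ CycleAdj v v
  cycle-irrefl 3≤n {v} a = go (collapse a)
    where
    collapse : CycleAdj v v → Succ v v
    collapse (inj₁ s) = s
    collapse (inj₂ s) = s
    go : ¬ Succ v v
    go (inj₁ e) = ℕ.1+n≢n (sym e)
    go (inj₂ (e , e₀)) with subst (3 ℕ.≤_) (trans (sym e) (cong suc e₀)) 3≤n
    ... | s≤s ()

  cycle-climb : (0<n : 0 ℕ.< n) (k : ℕ) (k<n : k ℕ.< n) →
                Star CycleAdj (fromℕ< 0<n) (fromℕ< k<n)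
  cycle-climb 0<n zero    _   = ε
  cycle-climb 0<n (suc k) k<n =
    cycle-climb 0<n k k′<n ◅◅ (inj₁ (inj₁ step) ◅ ε)
    where
    k′<n = ℕ.<-trans (ℕ.n<1+n k) k<n
    step = trans (toℕ-fromℕ< k<n) (cong suc (sym (toℕ-fromℕ< k′<n)))

  cycle-connected : 3 ℕ.≤ n → (u v : Fin n) → Star CycleAdj u v
  cycle-connected 3≤n u v = reverse swap (from-zero u) ◅◅ from-zero v
    where
    0<n : 0 ℕ.< n
    0<n = ℕ.≤-trans (s≤s z≤n) 3≤n
    from-zero : (x : Fin n) → Star CycleAdj (fromℕ< 0<n) x
    from-zero x = subst (Star CycleAdj _) (fromℕ<-toℕ x (toℕ<n x))
                        (cycle-climb 0<n (toℕ x) (toℕ<n x))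

cycle : (n : ℕ) → 3 ℕ.≤ n → Graph n
cycle n 3≤n = record
  { Adj        = CycleAdj
  ; Adj-sym    = swap
  ; Adj-irrefl = cycle-irrefl 3≤n
  ; w          = λ _ _ → 1ℚ
  ; w-sym      = λ _ → refl
  ; w-pos      = λ _ → positive⁻¹ 1ℚ
  ; connected  = cycle-connected 3≤n
  }

-- found : the queried vertex is revealed to be a target.
data Response (n : ℕ) : Set where
  toward : Fin n → Response n
  found  : Response n

toward-injective : ∀ {n} {u v : Fin n} → toward u ≡ toward v → u ≡ v
toward-injective refl = refl

_≟ᴿ_ : ∀ {n} (r s : Response n) → Dec (r ≡ s)
toward u ≟ᴿ toward v = map′ (cong toward) toward-injective (u Fin.≟ v)
toward _ ≟ᴿ found    = no λ ()
found    ≟ᴿ toward _ = no λ ()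
found    ≟ᴿ found    = yes refl

-- The responses received so far, the most recent one first.  The queries of a
-- deterministic algorithm are determined by the responses.
History : ℕ → Set
History n = List (Response n)

data Action (n : ℕ) : Set where
  query    : Fin n → Action n
  announce : Fin n → Action n

Algorithm : ℕ → Set
Algorithm n = History n → Action n

module _ {n : ℕ} (G : Graph n) where

  open Graph G

  -- The responses to a query at  v  that may be given when it directs to  t.
  -- By positivity of the weights,  v ∈N[ v , u ]  never holds, so  found  is the
  -- only one when  v ≡ t.
  Admissible : Fin n → Fin n → Response n → Set
  Admissible v t (toward u) = t ∈N[ v , u ]
  Admissible v t found      = v ≡ t

  module _ {k : ℕ} where

    -- reply h v i  is the response, after history  h, to a query at  v  that
    -- directs to the target of index  i.
    record Adversary : Set where
      field
        targets          : Fin k ↣ Fin n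
        reply            : History n → Fin n → Fin k → Response n

      target : Fin k → Fin n
      target = Injection.to targets

      field
        reply-admissible : ∀ h v i → Admissible v (target i) (reply h v i)

    module _ (p : Fin k → ℚ) where

      module _ (adv : Adversary) where

        open Adversary adv

        replyProbability : History n → Fin n → Response n → ℚ
        replyProbability h v r =
          sum λ i → if ⌊ reply h v i ≟ᴿ r ⌋ then p i else 0ℚ

        actionProbability : History n → Action n → Response n → ℚ
        actionProbability h (query v)    r = replyProbability h v r
        actionProbability h (announce _) r = 0ℚ

        -- The probability that the first  length h  queries of  A  are made and
        -- receive the responses  h.
        probability : Algorithm n → History n → ℚ
        probability A []      = 1ℚ
        probability A (r ∷ h) = probability A h * actionProbability h (A h) r

      Possible : Algorithm n → Adversary → History n → Set
      Possible A adv h = 0ℚ < probability adv A h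

      -- A vertex is announced only when it is certain to be a target.
      Certain : Algorithm n → Set
      Certain A = ∀ adv h z → Possible A adv h → A h ≡ announce z →
                  ∃[ i ] Adversary.target adv i ≡ z

uniform : (k : ℕ) .{{_ : NonZero k}} → Fin k → ℚ
uniform k _ = + 1 / k

{-# OPTIONS --safe #-}
module Submission where

-- Write k for the floor of n / 2.  The adversary answers every query at v by the
-- neighbour following v on the cycle, and this single sequence of answers stays
-- consistent with many target sets.  Indeed, let x and y be targets such that y
-- lies k steps after x.  From every vertex v other than y, one of x and y is
-- reached by between 1 and k forward steps, so that the following vertex is a
-- correct answer at v (response-next-near-antipodes).  All probabilities being
-- positive, a history of such answers is therefore possible as soon as y has not
-- been queried (forward-possible).
--
-- Suppose that such a history h, with queries Q, is followed by the announcement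
-- of a vertex z.  As long as Q has at most n - 3 elements, y can be chosen outside
-- Q, different from z, and different from the vertex k steps after z, which makes
-- x different from z as well (hidden-pair).  When there are fewer than n targets,
-- the other ones can avoid z too (injection-through).  Then h is possible although
-- z is not a target, so that the announcement was not certain (forward-queries).
-- Hence an algorithm that announces only certain targets can then be forced to make
-- n - 2 queries, and n - 2 is at least n / 2 - c.  In the remaining case of n = 2c
-- targets, the bound is 0.
--
-- On the way, the answers have to be shown correct for shortest paths over all
-- walks: with a forward steps leading from u to t, the distance from u to t is the
-- minimum of a and n - a (isDistance).

open import Defs
open import Data.Bool.Base using (if_then_else_)
open import Data.Fin.Base using (Fin; zero; suc; toℕ; fromℕ<; punchIn; punchOut; inject≤)
open import Data.Fin.Permutation using (Permutation′; _⟨$⟩ʳ_; insert)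
import Data.Fin.Permutation as Permutation
open import Data.Fin.Properties
  using (toℕ-fromℕ<; toℕ<n; toℕ-injective; punchIn-punchOut; punchOut-injective;
         inject≤-injective; suc-injective; injective⇒≤; ¬∀⟶∃¬)
import Data.Fin.Properties as Fin
open import Data.Integer.Base using (+_)
import Data.Integer.Base as ℤ
import Data.Integer.Properties as ℤ
open import Data.List.Base using (List; []; _∷_; length; lookup)
open import Data.List.Membership.Propositional using (_∈_; _∉_)
import Data.List.Membership.DecPropositional as DecMembership
open import Data.List.Relation.Unary.Any using (here; there; index)
open import Data.List.Relation.Unary.Any.Properties using (lookup-index)
open import Data.Nat.Base as ℕ using (ℕ; zero; suc; NonZero; z≤n; s≤s; _∸_; _⊓_; ⌊_/2⌋; ⌈_/2⌉)
open import Data.Nat.DivMod using (_%_; m≡m%n+[m/n]*n; m%n<n; m<n⇒m%n≡m; [m+kn]%n≡m%n)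
import Data.Nat.DivMod as ℕ
open import Data.Nat.Properties using (m*n≢0)
import Data.Nat.Properties as ℕ
open import Data.Nat.Tactic.RingSolver using (solve-∀)
open import Data.Product.Base using (_×_; _,_; ∃-syntax; Σ-syntax; proj₁; proj₂)
open import Data.Rational.Base using (ℚ; 0ℚ; 1ℚ; _+_; _/_; _-_; _≤_; _<_)
import Data.Rational.Base as ℚ
import Data.Rational.Properties as ℚ
import Data.Rational.Unnormalised.Base as ℚᵘ
import Data.Rational.Unnormalised.Properties as ℚᵘ
open import Algebra.Properties.CommutativeMonoid.Sum ℚ.+-0-commutativeMonoid using (sum)
open import Data.Sum.Base using (_⊎_; inj₁; inj₂)
open import Function.Base using (_∘_)
open import Function.Properties.Inverse using (↔⇒↣)
open import Function.Bundles using (_↣_; mk↣; Injection)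
open import Relation.Binary.Construct.Closure.ReflexiveTransitive using (ε; _◅_)
open import Relation.Binary.PropositionalEquality
open import Relation.Nullary.Decidable.Core using (yes; no; ⌊_⌋)
open import Relation.Nullary.Negation.Core using (contradiction)

-- Arithmetic and finite sets

remainder-unique : ∀ {n} .{{_ : NonZero n}} {x y} a b → x ℕ.< n → y ℕ.< n →
                   x ℕ.+ a ℕ.* n ≡ y ℕ.+ b ℕ.* n → x ≡ y
remainder-unique {n} {x} {y} a b x<n y<n eq = begin
  x                    ≡⟨ m<n⇒m%n≡m x<n ⟨
  x % n                ≡⟨ [m+kn]%n≡m%n x a n ⟨
  (x ℕ.+ a ℕ.* n) % n  ≡⟨ cong (_% n) eq ⟩
  (y ℕ.+ b ℕ.* n) % n  ≡⟨ [m+kn]%n≡m%n y b n ⟩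
  y % n                ≡⟨ m<n⇒m%n≡m y<n ⟩
  y                    ∎
  where open ≡-Reasoning

+-swapʳ : ∀ a b c → a ℕ.+ b ℕ.+ c ≡ a ℕ.+ c ℕ.+ b
+-swapʳ = solve-∀

-- If every element of Fin n occurred in xs, then its index would define an injection
-- from Fin n to the positions of xs.
∃-∉ : ∀ {n} (xs : List (Fin n)) → length xs ℕ.< n → ∃[ y ] y ∉ xs
∃-∉ {n} xs |xs|<n = ¬∀⟶∃¬ n (_∈ xs) (λ y → DecMembership._∈?_ Fin._≟_ y xs) λ all →
  ℕ.<⇒≱ |xs|<n (injective⇒≤ {f = λ x → index (all x)} λ {x} {y} eq →
    trans (lookup-index (all x)) (trans (cong (lookup xs) eq) (sym (lookup-index (all y)))))

-- A set of k elements of Fin n that contains x and y but not z, given as an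
-- injection: a permutation of Fin n sending 0, 1, 2 to z, x, y is restricted to
-- the indices 1, ..., k.
injection-through : ∀ {k n} → 2 ℕ.≤ k → k ℕ.< n → {x y z : Fin n} → z ≢ x → z ≢ y → x ≢ y →
  Σ[ ts ∈ Fin k ↣ Fin n ] let open Injection ts using (to) in
    (∀ i → to i ≢ z) × (∃[ i ] to i ≡ x) × (∃[ j ] to j ≡ y)
injection-through {n = suc n} (s≤s (s≤s z≤n)) (s≤s k≤n@(s≤s (s≤s _))) {x} {y} {z} z≢x z≢y x≢y =
  mk↣ {to = λ i → to (suc (inject≤ i k≤n))}
    (λ eq → inject≤-injective k≤n k≤n _ _ (suc-injective (injective eq))) ,
  (λ i eq → Fin.0≢1+n (injective {zero} {suc (inject≤ i k≤n)} (sym eq))) ,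
  (zero , punchIn-punchOut z≢x) ,
  (suc zero , trans (cong (punchIn z) (punchIn-punchOut x′≢y′)) (punchIn-punchOut z≢y))
  where
  x′≢y′ : punchOut z≢x ≢ punchOut z≢y
  x′≢y′ = x≢y ∘ punchOut-injective z≢x z≢y
  π : Permutation′ (suc n)
  π = insert zero z (insert zero (punchOut z≢x) (insert zero (punchOut x′≢y′) Permutation.id))
  open Injection (↔⇒↣ π) using (to; injective)

-- Rational numbers

sum-nonNegative : ∀ {k} (f : Fin k → ℚ) → (∀ i → 0ℚ ≤ f i) → 0ℚ ≤ sum f
sum-nonNegative {zero}  f 0≤f = ℚ.≤-refl
sum-nonNegative {suc k} f 0≤f = ℚ.+-mono-≤ (0≤f zero) (sum-nonNegative (f ∘ suc) (0≤f ∘ suc))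

sum-positive : ∀ {k} (f : Fin k → ℚ) → (∀ i → 0ℚ ≤ f i) → ∀ j → 0ℚ < f j → 0ℚ < sum f
sum-positive f 0≤f zero    0<fj = ℚ.+-mono-<-≤ 0<fj (sum-nonNegative (f ∘ suc) (0≤f ∘ suc))
sum-positive f 0≤f (suc j) 0<fj = ℚ.+-mono-≤-< (0≤f zero) (sum-positive (f ∘ suc) (0≤f ∘ suc) j 0<fj)

*-positive : ∀ {p q} → 0ℚ < p → 0ℚ < q → 0ℚ < p ℚ.* q
*-positive {p} {q} 0<p 0<q = ℚ.positive⁻¹ (p ℚ.* q)
  {{ℚ.pos*pos⇒pos p {{ℚ.positive 0<p}} q {{ℚ.positive 0<q}}}}

uniform-positive : ∀ k .{{_ : NonZero k}} i → 0ℚ < uniform k i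
uniform-positive k _ = ℚ.positive⁻¹ (+ 1 / k) {{ℚ.normalize-pos 1 k}}

n≤2l⇒n/2≤l : ∀ n l → n ℕ.≤ l ℕ.* 2 → (+ n / 2) ≤ (+ l / 1)
n≤2l⇒n/2≤l n l n≤2l = ℚ.toℚᵘ-cancel-≤
  (ℚᵘ.≤-respˡ-≃ (ℚᵘ.≃-sym (ℚ.toℚᵘ-fromℚᵘ (ℚᵘ.mkℚᵘ (+ n) 1)))
  (ℚᵘ.≤-respʳ-≃ (ℚᵘ.≃-sym (ℚ.toℚᵘ-fromℚᵘ (ℚᵘ.mkℚᵘ (+ l) 0)))
    (ℚᵘ.*≤* (subst₂ ℤ._≤_ (sym (ℤ.*-identityʳ (+ n))) (ℤ.pos-* l 2) (ℤ.+≤+ n≤2l)))))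

[l+c]/1≡l/1+c/1 : ∀ l c → + (l ℕ.+ c) / 1 ≡ (+ l / 1) + (+ c / 1)
[l+c]/1≡l/1+c/1 l c = ℚ.toℚᵘ-injective (ℚᵘ.≃-trans (ℚ.toℚᵘ-fromℚᵘ (ℚᵘ.mkℚᵘ (+ (l ℕ.+ c)) 0))
  (ℚᵘ.≃-sym (ℚᵘ.≃-trans (ℚ.toℚᵘ-homo-+ (+ l / 1) (+ c / 1))
    (ℚᵘ.≃-trans
      (ℚᵘ.+-cong (ℚ.toℚᵘ-fromℚᵘ (ℚᵘ.mkℚᵘ (+ l) 0)) (ℚ.toℚᵘ-fromℚᵘ (ℚᵘ.mkℚᵘ (+ c) 0)))
      (ℚᵘ.*≡* (cong (ℤ._* + 1) (cong₂ ℤ._+_ (ℤ.*-identityʳ (+ l)) (ℤ.*-identityʳ (+ c)))))))))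

n/2-c≤l : ∀ n c l → n ℕ.≤ (l ℕ.+ c) ℕ.* 2 → (+ n / 2) - (+ c / 1) ≤ + l / 1
n/2-c≤l n c l n≤2[l+c] = begin
  (+ n / 2) - (+ c / 1)                ≤⟨ ℚ.+-monoˡ-≤ (ℚ.- (+ c / 1)) n/2≤l+c ⟩
  ((+ l / 1) + (+ c / 1)) - (+ c / 1)  ≡⟨ ℚ.+-assoc (+ l / 1) (+ c / 1) _ ⟩
  (+ l / 1) + ((+ c / 1) - (+ c / 1))  ≡⟨ cong (_+_ (+ l / 1)) (ℚ.+-inverseʳ (+ c / 1)) ⟩
  (+ l / 1) + 0ℚ                       ≡⟨ ℚ.+-identityʳ _ ⟩
  + l / 1                              ∎
  where
  open ℚ.≤-Reasoning
  n/2≤l+c : (+ n / 2) ≤ (+ l / 1) + (+ c / 1)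
  n/2≤l+c = ℚ.≤-trans (n≤2l⇒n/2≤l n (l ℕ.+ c) n≤2[l+c]) (ℚ.≤-reflexive ([l+c]/1≡l/1+c/1 l c))

-- Arcs of the cycle

module Arcs (n : ℕ) .{{_ : NonZero n}} where

  -- The arc of d < n forward steps from u ends at v.  The equation holds modulo n;
  -- laps is the quotient, which is 0 or 1.
  record Arc (u : Fin n) (d : ℕ) (v : Fin n) : Set where
    constructor arc
    field
      length<n : d ℕ.< n
      laps     : ℕ
      position : toℕ u ℕ.+ d ≡ toℕ v ℕ.+ laps ℕ.* n

  open Arc

  arc-refl : ∀ u → Arc u 0 u
  arc-refl u = arc (ℕ.≤-<-trans z≤n (toℕ<n u)) 0 refl

  ahead : ∀ u {d} → d ℕ.< n → ∃[ v ] Arc u d v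
  ahead u {d} d<n = fromℕ< r<n , arc d<n (s ℕ./ n)
    (trans (m≡m%n+[m/n]*n s n) (cong (ℕ._+ (s ℕ./ n) ℕ.* n) (sym (toℕ-fromℕ< r<n))))
    where
    s   = toℕ u ℕ.+ d
    r<n = m%n<n s n

  between : ∀ u v → ∃[ d ] Arc u d v
  between u v with toℕ u ℕ.≤? toℕ v
  ... | yes u≤v = toℕ v ∸ toℕ u , arc (ℕ.≤-<-trans (ℕ.m∸n≤m _ (toℕ u)) (toℕ<n v)) 0
    (trans (ℕ.m+[n∸m]≡n u≤v) (sym (ℕ.+-identityʳ _)))
  ... | no u≰v = toℕ v ℕ.+ (n ∸ toℕ u) , arc
    (subst (toℕ v ℕ.+ (n ∸ toℕ u) ℕ.<_) u+[n∸u]≡n (ℕ.+-monoˡ-< (n ∸ toℕ u) (ℕ.≰⇒> u≰v))) 1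
    (begin
      toℕ u ℕ.+ (toℕ v ℕ.+ (n ∸ toℕ u))  ≡⟨ swap₃ (toℕ u) (toℕ v) (n ∸ toℕ u) ⟩
      toℕ v ℕ.+ (toℕ u ℕ.+ (n ∸ toℕ u))  ≡⟨ cong (toℕ v ℕ.+_) u+[n∸u]≡n ⟩
      toℕ v ℕ.+ n                        ≡⟨ cong (toℕ v ℕ.+_) (ℕ.*-identityˡ n) ⟨
      toℕ v ℕ.+ 1 ℕ.* n                  ∎)
    where
    open ≡-Reasoning
    u+[n∸u]≡n = ℕ.m+[n∸m]≡n (ℕ.<⇒≤ (toℕ<n u))
    swap₃ : ∀ a b c → a ℕ.+ (b ℕ.+ c) ≡ b ℕ.+ (a ℕ.+ c)
    swap₃ = solve-∀

  arc-length-unique : ∀ {u v d e} → Arc u d v → Arc u e v → d ≡ e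
  arc-length-unique {u} {v} {d} {e} (arc d<n a p) (arc e<n b q) =
    remainder-unique b a d<n e<n (ℕ.+-cancelˡ-≡ (toℕ u) _ _ (begin
      toℕ u ℕ.+ (d ℕ.+ b ℕ.* n)          ≡⟨ ℕ.+-assoc (toℕ u) d _ ⟨
      toℕ u ℕ.+ d ℕ.+ b ℕ.* n            ≡⟨ cong (ℕ._+ b ℕ.* n) p ⟩
      toℕ v ℕ.+ a ℕ.* n ℕ.+ b ℕ.* n      ≡⟨ +-swapʳ (toℕ v) (a ℕ.* n) (b ℕ.* n) ⟩
      toℕ v ℕ.+ b ℕ.* n ℕ.+ a ℕ.* n      ≡⟨ cong (ℕ._+ a ℕ.* n) q ⟨
      toℕ u ℕ.+ e ℕ.+ a ℕ.* n            ≡⟨ ℕ.+-assoc (toℕ u) e _ ⟩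
      toℕ u ℕ.+ (e ℕ.+ a ℕ.* n)          ∎))
    where
    open ≡-Reasoning

  arc-end-unique : ∀ {u v w d} → Arc u d v → Arc u d w → v ≡ w
  arc-end-unique (arc _ a p) (arc _ b q) =
    toℕ-injective (remainder-unique a b (toℕ<n _) (toℕ<n _) (trans (sym p) q))

  arc-start-unique : ∀ {u v w d} → Arc u d w → Arc v d w → u ≡ v
  arc-start-unique {u} {v} {w} {d} (arc _ a p) (arc _ b q) =
    toℕ-injective (remainder-unique b a (toℕ<n u) (toℕ<n v) (ℕ.+-cancelʳ-≡ d _ _ (begin
      toℕ u ℕ.+ b ℕ.* n ℕ.+ d        ≡⟨ +-swapʳ (toℕ u) (b ℕ.* n) d ⟩
      toℕ u ℕ.+ d ℕ.+ b ℕ.* n        ≡⟨ cong (ℕ._+ b ℕ.* n) p ⟩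
      toℕ w ℕ.+ a ℕ.* n ℕ.+ b ℕ.* n  ≡⟨ +-swapʳ (toℕ w) (a ℕ.* n) (b ℕ.* n) ⟩
      toℕ w ℕ.+ b ℕ.* n ℕ.+ a ℕ.* n  ≡⟨ cong (ℕ._+ a ℕ.* n) q ⟨
      toℕ v ℕ.+ d ℕ.+ a ℕ.* n        ≡⟨ +-swapʳ (toℕ v) d (a ℕ.* n) ⟩
      toℕ v ℕ.+ a ℕ.* n ℕ.+ d        ∎)))
    where
    open ≡-Reasoning

  -- Stated apart from arc-compose, as arc-close uses it for d + e ≡ n.
  private
    windings : ∀ {u v w d e} (α : Arc u d v) (β : Arc v e w) →
               toℕ u ℕ.+ (d ℕ.+ e) ≡ toℕ w ℕ.+ (laps α ℕ.+ laps β) ℕ.* n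
    windings {u} {v} {w} {d} {e} (arc _ a p) (arc _ b q) = begin
      toℕ u ℕ.+ (d ℕ.+ e)                ≡⟨ ℕ.+-assoc (toℕ u) d e ⟨
      toℕ u ℕ.+ d ℕ.+ e                  ≡⟨ cong (ℕ._+ e) p ⟩
      toℕ v ℕ.+ a ℕ.* n ℕ.+ e            ≡⟨ shuffle (toℕ v) a n e ⟩
      (toℕ v ℕ.+ e) ℕ.+ a ℕ.* n          ≡⟨ cong (ℕ._+ a ℕ.* n) q ⟩
      toℕ w ℕ.+ b ℕ.* n ℕ.+ a ℕ.* n      ≡⟨ collect (toℕ w) a b n ⟩
      toℕ w ℕ.+ (a ℕ.+ b) ℕ.* n          ∎
      where
      open ≡-Reasoning
      shuffle : ∀ v a n e → v ℕ.+ a ℕ.* n ℕ.+ e ≡ (v ℕ.+ e) ℕ.+ a ℕ.* n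
      shuffle = solve-∀
      collect : ∀ w a b n → w ℕ.+ b ℕ.* n ℕ.+ a ℕ.* n ≡ w ℕ.+ (a ℕ.+ b) ℕ.* n
      collect = solve-∀

  arc-compose : ∀ {u v w d e} → Arc u d v → Arc v e w → d ℕ.+ e ℕ.< n → Arc u (d ℕ.+ e) w
  arc-compose α β d+e<n = arc d+e<n (laps α ℕ.+ laps β) (windings α β)

  arc-close : ∀ {u v w d e} → Arc u d v → Arc v e w → d ℕ.+ e ≡ n → u ≡ w
  arc-close {u} α β d+e≡n = toℕ-injective
    (remainder-unique 1 (laps α ℕ.+ laps β) (toℕ<n _) (toℕ<n _)
      (trans (cong (toℕ u ℕ.+_) (trans (ℕ.*-identityˡ n) (sym d+e≡n))) (windings α β)))

  -- The vertex d steps before v is found n - d steps after v.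
  behind : ∀ v {d} → 0 ℕ.< d → d ℕ.< n → ∃[ u ] Arc u d v
  behind v {d} 0<d d<n =
    let u , α = ahead v (ℕ.∸-monoʳ-< 0<d (ℕ.<⇒≤ d<n))
        w , β = ahead u d<n
    in u , subst (Arc u d) (sym (arc-close α β (ℕ.m∸n+n≡m (ℕ.<⇒≤ d<n)))) β

  arc-split : ∀ {u v w d e} → Arc u (d ℕ.+ e) w → Arc v e w → Arc u d v
  arc-split {u} {v} {w} {d} {e} α β =
    let x , γ = ahead u (ℕ.≤-<-trans (ℕ.m≤m+n d e) (length<n α))
        y , δ = ahead x (length<n β)
        y≡w   = arc-end-unique (arc-compose γ δ (length<n α)) α
    in subst (Arc u d) (arc-start-unique (subst (Arc x e) y≡w δ) β) γ

  -- The number of forward steps from u to v.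
  cw : Fin n → Fin n → ℕ
  cw u v = proj₁ (between u v)

  cw-arc : ∀ u v → Arc u (cw u v) v
  cw-arc u v = proj₂ (between u v)

  cw-unique : ∀ {u v d} → Arc u d v → cw u v ≡ d
  cw-unique = arc-length-unique (cw-arc _ _)

  -- The distance on the cycle, going the shorter way round (see isDistance below).
  D : Fin n → Fin n → ℕ
  D u v = cw u v ⊓ (n ∸ cw u v)

  D-self : ∀ u → D u u ≡ 0
  D-self u = cong (λ d → d ⊓ (n ∸ d)) (cw-unique (arc-refl u))

  D≡0⇒≡ : ∀ {u v} → D u v ≡ 0 → u ≡ v
  D≡0⇒≡ {u} {v} D≡0 with ℕ.⊓-sel (cw u v) (n ∸ cw u v)
  ... | inj₁ eq = arc-end-unique (arc-refl u)
                    (subst (λ d → Arc u d v) (trans (sym eq) D≡0) (cw-arc u v))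
  ... | inj₂ eq = contradiction (trans (sym eq) D≡0) (ℕ.m>n⇒m∸n≢0 (Arc.length<n (cw-arc u v)))

-- Distances in the cycle

module Cycle {n : ℕ} (3≤n : 3 ℕ.≤ n) where

  open Arcs n {{ℕ.>-nonZero (ℕ.≤-trans (s≤s z≤n) 3≤n)}} public

  1<n : 1 ℕ.< n
  1<n = ℕ.≤-trans (s≤s (s≤s z≤n)) 3≤n

  succ⇒arc : ∀ {u v : Fin n} → Succ u v → Arc u 1 v
  succ⇒arc {u} (inj₁ eq) =
    arc 1<n 0 (trans (ℕ.+-comm (toℕ u) 1) (trans (sym eq) (sym (ℕ.+-identityʳ _))))
  succ⇒arc {u} {v} (inj₂ (eq , eq₀)) = arc 1<n 1 (begin
    toℕ u ℕ.+ 1        ≡⟨ ℕ.+-comm (toℕ u) 1 ⟩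
    suc (toℕ u)        ≡⟨ eq ⟩
    n                  ≡⟨ ℕ.*-identityˡ n ⟨
    1 ℕ.* n            ≡⟨ cong (ℕ._+ 1 ℕ.* n) eq₀ ⟨
    toℕ v ℕ.+ 1 ℕ.* n  ∎)
    where open ≡-Reasoning

  successor : ∀ u → ∃[ v ] Succ u v
  successor u with suc (toℕ u) ℕ.<? n
  ... | yes u+1<n = fromℕ< u+1<n , inj₁ (toℕ-fromℕ< u+1<n)
  ... | no  u+1≮n = fromℕ< 0<n , inj₂ (ℕ.≤-antisym (toℕ<n u) (ℕ.≮⇒≥ u+1≮n) , toℕ-fromℕ< 0<n)
    where 0<n = ℕ.<-trans (s≤s z≤n) 1<n

  -- The vertices that follow and precede a vertex on the cycle.
  next : Fin n → Fin n
  next u = proj₁ (successor u)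

  predecessor : ∀ v → ∃[ u ] Succ u v
  predecessor v =
    let u , α = behind v (s≤s z≤n) 1<n
        w , s = successor u
    in u , subst (Succ u) (arc-end-unique (succ⇒arc s) α) s

  prev : Fin n → Fin n
  prev v = proj₁ (predecessor v)

  -- Stepping back from v to u makes the arc to t longer by one, unless it would
  -- then go once round.
  succ-cw : ∀ {u v} t → Succ u v →
            (cw u t ≡ suc (cw v t)) ⊎ (u ≡ t × suc (cw v t) ≡ n)
  succ-cw {u} {v} t s with suc (cw v t) ℕ.<? n
  ... | yes lt = inj₁ (cw-unique (arc-compose (succ⇒arc s) (cw-arc v t) lt))
  ... | no  ≮  = inj₂ (arc-close (succ⇒arc s) (cw-arc v t) eq , eq)
    where eq = ℕ.≤-antisym (Arc.length<n (cw-arc v t)) (ℕ.≮⇒≥ ≮)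

  private
    n∸d≤1+n∸[1+d] : ∀ d → n ∸ d ℕ.≤ suc (n ∸ suc d)
    n∸d≤1+n∸[1+d] d = ℕ.≤-trans (ℕ.m≤n+m∸n (n ∸ d) 1)
      (ℕ.≤-reflexive (cong suc (trans (ℕ.∸-+-assoc n d 1) (cong (n ∸_) (ℕ.+-comm d 1)))))

    n∸d≡1 : ∀ {d} → suc d ≡ n → n ∸ d ≡ 1
    n∸d≡1 {d} refl = ℕ.m+n∸n≡m 1 d

  -- By D-adj, the function u ↦ D u t changes by at most one along an edge, so that it
  -- is a lower bound for the weights of walks to t; by D-neighbour below, some
  -- neighbour decreases it, so that the bound is attained.
  D-succ : ∀ {u v} t → Succ u v → D u t ℕ.≤ suc (D v t) × D v t ℕ.≤ suc (D u t)
  D-succ {u} {v} t s with succ-cw t s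
  ... | inj₁ eq rewrite eq =
    ℕ.⊓-mono-≤ (ℕ.≤-refl {suc (cw v t)})
      (ℕ.≤-trans (ℕ.∸-monoʳ-≤ n (ℕ.n≤1+n (cw v t))) (ℕ.n≤1+n _)) ,
    ℕ.⊓-mono-≤ (ℕ.m≤n+m (cw v t) 2) (n∸d≤1+n∸[1+d] (cw v t))
  ... | inj₂ (refl , eq) =
    subst (ℕ._≤ suc (D v u)) (sym (D-self u)) z≤n ,
    ℕ.≤-trans (ℕ.m⊓n≤n (cw v t) _) (ℕ.≤-trans (ℕ.≤-reflexive (n∸d≡1 eq)) (s≤s z≤n))

  D-adj : ∀ {u v} t → CycleAdj u v → D u t ℕ.≤ suc (D v t)
  D-adj t (inj₁ s) = proj₁ (D-succ t s)
  D-adj t (inj₂ s) = proj₂ (D-succ t s)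

  D-next : ∀ {v t} → v ≢ t → cw v t ℕ.≤ n ∸ cw v t → D v t ≡ suc (D (next v) t)
  D-next {v} {t} v≢t d≤n∸d with succ-cw t (proj₂ (successor v))
  ... | inj₂ (v≡t , _) = contradiction v≡t v≢t
  ... | inj₁ eq = begin
    D v t                  ≡⟨ ℕ.m≤n⇒m⊓n≡m d≤n∸d ⟩
    cw v t                 ≡⟨ eq ⟩
    suc (cw (next v) t)    ≡⟨ cong suc (ℕ.m≤n⇒m⊓n≡m e≤n∸e) ⟨
    suc (D (next v) t)     ∎
    where
    open ≡-Reasoning
    e≤d : cw (next v) t ℕ.≤ cw v t
    e≤d = ℕ.≤-trans (ℕ.n≤1+n _) (ℕ.≤-reflexive (sym eq))
    e≤n∸e = ℕ.≤-trans e≤d (ℕ.≤-trans d≤n∸d (ℕ.∸-monoʳ-≤ n e≤d))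

  D-prev : ∀ {v t} → n ∸ cw v t ℕ.< cw v t → D v t ≡ suc (D (prev v) t)
  D-prev {v} {t} n∸d<d with succ-cw t (proj₂ (predecessor v))
  ... | inj₁ eq = begin
    D v t                              ≡⟨ ℕ.m≥n⇒m⊓n≡n (ℕ.<⇒≤ n∸d<d) ⟩
    n ∸ cw v t                         ≡⟨ ℕ.+-∸-assoc 1 (Arc.length<n (cw-arc v t)) ⟩
    suc (n ∸ suc (cw v t))             ≡⟨ cong (λ e → suc (n ∸ e)) eq ⟨
    suc (n ∸ cw (prev v) t)            ≡⟨ cong suc (ℕ.m≥n⇒m⊓n≡n n∸e≤e) ⟨
    suc (D (prev v) t)                 ∎
    where
    open ≡-Reasoning
    d≤e : cw v t ℕ.≤ cw (prev v) t
    d≤e = ℕ.≤-trans (ℕ.n≤1+n _) (ℕ.≤-reflexive (sym eq))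
    n∸e≤e = ℕ.≤-trans (ℕ.∸-monoʳ-≤ n d≤e) (ℕ.≤-trans (ℕ.<⇒≤ n∸d<d) d≤e)
  ... | inj₂ (p≡t , eq) = begin
    D v t               ≡⟨ ℕ.m≥n⇒m⊓n≡n (ℕ.<⇒≤ n∸d<d) ⟩
    n ∸ cw v t          ≡⟨ n∸d≡1 eq ⟩
    1                   ≡⟨ cong suc (trans (cong (λ p → D p t) p≡t) (D-self t)) ⟨
    suc (D (prev v) t)  ∎
    where open ≡-Reasoning

  G : Graph n
  G = cycle n 3≤n

  open Graph G

  -- The embedding of ℕ in ℚ, defined like the weight of a walk of m unit edges.
  ι : ℕ → ℚ
  ι zero    = 0ℚ
  ι (suc m) = 1ℚ + ι m

  0≤ι : ∀ m → 0ℚ ≤ ι m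
  0≤ι zero    = ℚ.≤-refl
  0≤ι (suc m) = ℚ.+-mono-≤ (ℚ.nonNegative⁻¹ 1ℚ) (0≤ι m)

  ι-mono-≤ : ∀ {l m} → l ℕ.≤ m → ι l ≤ ι m
  ι-mono-≤ {m = m} z≤n = 0≤ι m
  ι-mono-≤ (s≤s l≤m)   = ℚ.+-monoʳ-≤ 1ℚ (ι-mono-≤ l≤m)

  D≤weight : ∀ {u t} (π : Walk u t) → ι (D u t) ≤ weight π
  D≤weight {u} ε = ℚ.≤-reflexive (cong ι (D-self u))
  D≤weight {t = t} (a ◅ π) =
    ℚ.≤-trans (ι-mono-≤ (D-adj t a)) (ℚ.+-monoʳ-≤ 1ℚ (D≤weight π))

  -- For v ≢ t, the first vertex after v on a shortest path to t; ties are broken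
  -- forward.  (For v ≡ t it is an irrelevant value.)
  neighbour : Fin n → Fin n → Fin n
  neighbour v t with cw v t ℕ.≤? n ∸ cw v t
  ... | yes _ = next v
  ... | no  _ = prev v

  neighbour-adj : ∀ v t → CycleAdj v (neighbour v t)
  neighbour-adj v t with cw v t ℕ.≤? n ∸ cw v t
  ... | yes _ = inj₁ (proj₂ (successor v))
  ... | no  _ = inj₂ (proj₂ (predecessor v))

  D-neighbour : ∀ {v t} → v ≢ t → D v t ≡ suc (D (neighbour v t) t)
  D-neighbour {v} {t} v≢t with cw v t ℕ.≤? n ∸ cw v t
  ... | yes ≤ = D-next v≢t ≤
  ... | no  ≰ = D-prev (ℕ.≰⇒> ≰)

  geodesic : ∀ m {u t} → D u t ≡ m → Σ[ π ∈ Walk u t ] weight π ≡ ι m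
  geodesic zero    {u} {t} D≡0 with refl ← D≡0⇒≡ {u} {t} D≡0 = ε , refl
  geodesic (suc m) {u} {t} D≡1+m =
    let π , eq = geodesic m (ℕ.suc-injective (trans (sym (D-neighbour u≢t)) D≡1+m))
    in neighbour-adj u t ◅ π , cong (_+_ 1ℚ) eq
    where
    u≢t : u ≢ t
    u≢t refl = ℕ.0≢1+n (trans (sym (D-self u)) D≡1+m)

  isDistance : ∀ u t → IsDistance u t (ι (D u t))
  isDistance u t = geodesic (D u t) refl , D≤weight

  -- The adversary and its targets

  -- The response to a query at v that directs to t; on a tie it is the next vertex.
  response : Fin n → Fin n → Response n
  response v t with v Fin.≟ t
  ... | yes _ = found
  ... | no  _ = toward (neighbour v t)

  response-admissible : ∀ v t → Admissible G v t (response v t)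
  response-admissible v t with v Fin.≟ t
  ... | yes v≡t = v≡t
  ... | no  v≢t = neighbour-adj v t , ι (D (neighbour v t) t) , isDistance _ t ,
    subst (λ m → IsDistance v t (ι m)) (D-neighbour v≢t) (isDistance v t)

  response-next : ∀ {v t d} → 0 ℕ.< d → d ℕ.≤ n ∸ d → Arc v d t → response v t ≡ toward (next v)
  response-next {v} {t} {d} 0<d d≤n∸d α with v Fin.≟ t
  ... | yes refl = contradiction (arc-length-unique (arc-refl v) α) (ℕ.<⇒≢ 0<d)
  ... | no  _ with cw v t ℕ.≤? n ∸ cw v t
  ...   | yes _ = refl
  ...   | no  ≰ = contradiction (subst (λ e → e ℕ.≤ n ∸ e) (sym (cw-unique α)) d≤n∸d) ≰

  adversary : ∀ {k} → Fin k ↣ Fin n → Adversary G {k}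
  adversary ts = record
    { targets          = ts
    ; reply            = λ _ v i → response v (Injection.to ts i)
    ; reply-admissible = λ _ v i → response-admissible v (Injection.to ts i)
    }

  -- An adversary with k targets, none of which is z, that can direct every query at z
  -- or at a vertex of Q to the next vertex, whatever the history.
  record Evasive (k : ℕ) (z : Fin n) (Q : List (Fin n)) : Set where
    field
      adv      : Adversary G {k}
      avoids   : ∀ i → Adversary.target adv i ≢ z
      forwards : ∀ {v} → v ∈ z ∷ Q → ∃[ i ] ∀ h → Adversary.reply adv h v i ≡ toward (next v)

  1≤⌊n/2⌋ : 1 ℕ.≤ ⌊ n /2⌋
  1≤⌊n/2⌋ = ℕ.⌊n/2⌋-mono 1<n

  ⌊n/2⌋<n : ⌊ n /2⌋ ℕ.< n
  ⌊n/2⌋<n = ℕ.<-≤-trans (ℕ.m<m+n _ (ℕ.≤-trans 1≤⌊n/2⌋ (ℕ.⌊n/2⌋≤⌈n/2⌉ n)))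
                        (ℕ.≤-reflexive (ℕ.⌊n/2⌋+⌈n/2⌉≡n n))

  ≤⌊n/2⌋⇒≤n∸ : ∀ {d} → d ℕ.≤ ⌊ n /2⌋ → d ℕ.≤ n ∸ d
  ≤⌊n/2⌋⇒≤n∸ {d} d≤k = ℕ.m+n≤o⇒m≤o∸n d (begin
    d ℕ.+ d                ≤⟨ ℕ.+-mono-≤ d≤k (ℕ.≤-trans d≤k (ℕ.⌊n/2⌋≤⌈n/2⌉ n)) ⟩
    ⌊ n /2⌋ ℕ.+ ⌈ n /2⌉    ≡⟨ ℕ.⌊n/2⌋+⌈n/2⌉≡n n ⟩
    n                      ∎)
    where open ℕ.≤-Reasoning

  -- If y is d steps after v with d ≤ k, where k is the floor of n / 2, then y is
  -- reached forward from v; otherwise x is d - k steps after v, and d - k ≤ k.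
  response-next-near-antipodes : ∀ {v x y} → Arc x ⌊ n /2⌋ y → v ≢ y →
    response v x ≡ toward (next v) ⊎ response v y ≡ toward (next v)
  response-next-near-antipodes {v} {x} {y} α v≢y with cw v y ℕ.≤? ⌊ n /2⌋
  ... | yes d≤k = inj₂ (response-next (ℕ.n≢0⇒n>0 d≢0) (≤⌊n/2⌋⇒≤n∸ d≤k) (cw-arc v y))
    where
    d≢0 : cw v y ≢ 0
    d≢0 d≡0 = v≢y (arc-end-unique (arc-refl v) (subst (λ d → Arc v d y) d≡0 (cw-arc v y)))
  ... | no d≰k = inj₁ (response-next (ℕ.m<n⇒0<n∸m k<d) (≤⌊n/2⌋⇒≤n∸ e≤k)
                         (arc-split (subst (λ d → Arc v d y) (sym e+k≡d) (cw-arc v y)) α))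
    where
    k<d = ℕ.≰⇒> d≰k
    e+k≡d : (cw v y ∸ ⌊ n /2⌋) ℕ.+ ⌊ n /2⌋ ≡ cw v y
    e+k≡d = ℕ.m∸n+n≡m (ℕ.<⇒≤ k<d)
    e≤k : cw v y ∸ ⌊ n /2⌋ ℕ.≤ ⌊ n /2⌋
    e≤k = ℕ.m≤n+o⇒m∸n≤o _ ⌊ n /2⌋ (ℕ.s≤s⁻¹ (begin
      suc (cw v y)                 ≤⟨ Arc.length<n (cw-arc v y) ⟩
      n                            ≡⟨ ℕ.⌊n/2⌋+⌈n/2⌉≡n n ⟨
      ⌊ n /2⌋ ℕ.+ ⌈ n /2⌉          ≤⟨ ℕ.+-monoʳ-≤ ⌊ n /2⌋ (ℕ.⌊n/2⌋-mono (ℕ.n≤1+n (suc n))) ⟩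
      ⌊ n /2⌋ ℕ.+ suc ⌊ n /2⌋      ≡⟨ ℕ.+-suc ⌊ n /2⌋ ⌊ n /2⌋ ⟩
      suc (⌊ n /2⌋ ℕ.+ ⌊ n /2⌋)    ∎))
      where open ℕ.≤-Reasoning

  -- The vertex z′ is excluded as it is the value of y for which x would be z.
  hidden-pair : ∀ z Q → 2 ℕ.+ length Q ℕ.< n →
    ∃[ x ] ∃[ y ] Arc x ⌊ n /2⌋ y × z ≢ x × y ∉ z ∷ Q
  hidden-pair z Q |Q|+2<n
    with z′ , γ ← ahead z ⌊n/2⌋<n
    with y , y∉ ← ∃-∉ (z′ ∷ z ∷ Q) |Q|+2<n
    with x , α ← behind y 1≤⌊n/2⌋ ⌊n/2⌋<n
    = x , y , α , (λ { refl → y∉ (here (arc-end-unique α γ)) }) , y∉ ∘ there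

  evasive : ∀ {k} z Q → 2 ℕ.≤ k → k ℕ.< n → 2 ℕ.+ length Q ℕ.< n → Evasive k z Q
  evasive z Q 2≤k k<n |Q|+2<n
    with x , y , α , z≢x , y∉ ← hidden-pair z Q |Q|+2<n
    with ts , avoids , (i , tᵢ≡x) , (j , tⱼ≡y) ← injection-through 2≤k k<n
      z≢x (λ { refl → y∉ (here refl) })
      (λ { refl → ℕ.<⇒≢ 1≤⌊n/2⌋ (arc-length-unique (arc-refl x) α) })
    = record { adv = adversary ts ; avoids = avoids ; forwards = forwards }
    where
    forwards : ∀ {v} → v ∈ z ∷ Q →
      ∃[ i ] (History n → response v (Injection.to ts i) ≡ toward (next v))
    forwards {v} v∈ with response-next-near-antipodes α (λ { refl → y∉ v∈ })
    ... | inj₁ eq = i , λ _ → trans (cong (response v) tᵢ≡x) eq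
    ... | inj₂ eq = j , λ _ → trans (cong (response v) tⱼ≡y) eq

  -- Forced histories

  -- Forward A Q h says that A, when each of its queries is answered by the next
  -- vertex, starts with queries at the vertices of Q and receives the responses h;
  -- both lists have the most recent entry first.
  data Forward (A : Algorithm n) : List (Fin n) → History n → Set where
    []  : Forward A [] []
    _∷_ : ∀ {v Q h} → A h ≡ query v → Forward A Q h → Forward A (v ∷ Q) (toward (next v) ∷ h)

  module _ (A : Algorithm n) {k : ℕ} (p : Fin k → ℚ) (0<p : ∀ i → 0ℚ < p i) where

    replyProbability-positive : (adv : Adversary G {k}) →
      ∀ h v i {r} → Adversary.reply adv h v i ≡ r → 0ℚ < replyProbability G p adv h v r
    replyProbability-positive adv h v i {r} eq = sum-positive f 0≤f i 0<fᵢ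
      where
      open Adversary adv using (reply)
      f : Fin k → ℚ
      f j = if ⌊ reply h v j ≟ᴿ r ⌋ then p j else 0ℚ
      0≤f : ∀ j → 0ℚ ≤ f j
      0≤f j with reply h v j ≟ᴿ r
      ... | yes _ = ℚ.<⇒≤ (0<p j)
      ... | no  _ = ℚ.≤-refl
      0<fᵢ : 0ℚ < f i
      0<fᵢ with reply h v i ≟ᴿ r
      ... | yes _  = 0<p i
      ... | no  ≢r = contradiction eq ≢r

    forward-possible : ∀ (adv : Adversary G {k}) {Q h} → Forward A Q h →
      (∀ {v} → v ∈ Q → ∃[ i ] ∀ h → Adversary.reply adv h v i ≡ toward (next v)) →
      Possible G p A adv h
    forward-possible adv [] forwards = ℚ.positive⁻¹ 1ℚ
    forward-possible adv (_∷_ {v} {h = h} Ah≡ F) forwards = *-positive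
      (forward-possible adv F (forwards ∘ there))
      (subst (λ a → 0ℚ < actionProbability G p adv h a (toward (next v))) (sym Ah≡)
        (let i , eq = forwards (here refl) in replyProbability-positive adv h v i (eq h)))

    module _ (certain : Certain G p A) (2≤k : 2 ℕ.≤ k) (k<n : k ℕ.< n) where

      -- An announcement of z after h would be wrong for an evasive adversary with
      -- respect to z, for which h is possible.
      forward-queries : ∀ {Q h} → Forward A Q h → 2 ℕ.+ length Q ℕ.< n → ∃[ v ] A h ≡ query v
      forward-queries {Q} {h} F |Q|+2<n with A h in Ah≡
      ... | query v    = v , refl
      ... | announce z =
        let open Evasive (evasive z Q 2≤k k<n |Q|+2<n)
            i , tᵢ≡z = certain adv h z (forward-possible adv F (forwards ∘ there)) Ah≡
        in contradiction tᵢ≡z (avoids i)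

      forward-history : ∀ m → 2 ℕ.+ m ℕ.≤ n →
        ∃[ Q ] ∃[ h ] (Forward A Q h × length Q ≡ m × length h ≡ m)
      forward-history zero    _ = [] , [] , [] , refl , refl
      forward-history (suc m) m+3≤n with forward-history m (ℕ.<⇒≤ m+3≤n)
      ... | Q , h , F , refl , |h|≡ =
        let v , Ah≡ = forward-queries F m+3≤n
        in v ∷ Q , toward (next v) ∷ h , Ah≡ ∷ F , refl , cong suc |h|≡

      -- The adversaries that refute announcements differ from step to step, and so does
      -- the one for which the whole history is possible: it has to answer at the
      -- last query v as well, for which v takes the place of the announced vertex.
      long-possible-history : ∀ m → 2 ℕ.+ m ℕ.< n →
        Σ[ adv ∈ Adversary G ] ∃[ h ] (Possible G p A adv h × length h ≡ suc m)
      long-possible-history m m+2<n with forward-history m (ℕ.<⇒≤ m+2<n)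
      ... | Q , h , F , refl , |h|≡ =
        let v , Ah≡ = forward-queries F m+2<n
            open Evasive (evasive v Q 2≤k k<n m+2<n)
        in adv , toward (next v) ∷ h , forward-possible adv (Ah≡ ∷ F) forwards , cong suc |h|≡

theorem7 : (c : ℕ) .{{_ : NonZero c}} (n : ℕ) (3≤n : 3 ℕ.≤ n) → 2 ℕ.* c ℕ.≤ n →
    let G = cycle n 3≤n
        p = uniform (2 ℕ.* c) {{m*n≢0 2 c}}
    in (A : Algorithm n) → Certain G p A →
       Σ[ adv ∈ Adversary G ] ∃[ h ]
         (Possible G p A adv h × (+ n / 2) - (+ c / 1) ≤ + length h / 1)
theorem7 c@(suc c′) n@(suc (suc (suc m))) 3≤n@(s≤s (s≤s (s≤s z≤n))) 2c≤n A certain with 2 ℕ.* c ℕ.<? n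
... | yes 2c<n =
  let adv , h , possible , |h|≡1+m = Cycle.long-possible-history 3≤n A
        (uniform (2 ℕ.* c) {{m*n≢0 2 c}}) (uniform-positive (2 ℕ.* c) {{m*n≢0 2 c}}) certain
        (ℕ.*-monoʳ-≤ 2 (s≤s z≤n)) 2c<n m (ℕ.n<1+n (2 ℕ.+ m))
  in adv , h , possible ,
     n/2-c≤l n c (length h) (subst (λ l → n ℕ.≤ (l ℕ.+ c) ℕ.* 2) (sym |h|≡1+m) n≤2[1+m+c])
  where
  n≤2[1+m+c] : n ℕ.≤ (suc m ℕ.+ c) ℕ.* 2
  n≤2[1+m+c] = ℕ.≤-trans (ℕ.m≤m+n n (suc m ℕ.+ 2 ℕ.* c′)) (ℕ.≤-reflexive (regroup m c′))
    where
    regroup : ∀ m c′ → 3 ℕ.+ m ℕ.+ (suc m ℕ.+ 2 ℕ.* c′) ≡ (suc m ℕ.+ suc c′) ℕ.* 2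
    regroup = solve-∀
-- Every vertex is a target, and the empty history is long enough.
... | no 2c≮n =
  Cycle.adversary 3≤n (mk↣ (λ {i} {j} → inject≤-injective 2c≤n 2c≤n i j)) , [] ,
  ℚ.positive⁻¹ 1ℚ ,
  n/2-c≤l n c 0 (ℕ.≤-trans (ℕ.≮⇒≥ 2c≮n) (ℕ.≤-reflexive (ℕ.*-comm 2 c)))
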